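{- Let $0\le\theta\le1$. (i) If $0\le\theta\le1/3$, then for every $\epsilon>0$ there exists a weighted digraph $D$ with $w(D)>0$ and $\theta(D)=\theta$ such that $\mathrm{mac}(D)<(1+\epsilon)\,l(\theta)\,w(D)$. (ii) If $1/3<\theta\le1$, then there exists a weighted digraph $D$ with $w(D)>0$ and $\theta(D)=\theta$ such that $\mathrm{mac}(D)=\theta\cdot w(D)$ $(=l(\theta)w(D))$.
   Context: A weighted digraph $D=(V,A,w)$ is a digraph without loops or parallel arcs (opposite arcs allowed) with weights $w:A\to\mathbb{R}_{\ge0}$; $w(D)$ is the total arc weight. For a partition $(X,Y)$ of $V$, $w(X,Y)$ is the total weight of arcs from $X$ to $Y$, and $\mathrm{mac}(D)=\max_{(X,Y)}w(X,Y)$. For $v\in V$, $r(v)=w^+(v)-w^-(v)$ (total weight leaving minus total weight entering $v$); $r^+(D)=\sum_{r(x)>0}r(x)$; $\theta(D)=r^+(D)/w(D)$. For $0\le\theta\le1$, $l(\theta)=\frac14+\frac{\theta^2}{4(1-2\theta)}$ if $\theta<1/3$ and $l(\theta)=\theta$ if $\theta\ge1/3$. -}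

module Defs where

open import Algebra.Bundles using (CommutativeRing)
import Algebra.Properties.CommutativeMonoid.Sum as Sum
open import Algebra.Core using (Op₁; Op₂)
open import Algebra.Structures using (IsCommutativeRing)
open import Data.Bool.Base using (Bool; true; false; T; _∧_; if_then_else_)
open import Data.Bool.Properties using (T?)
open import Data.Fin.Base using (Fin)
open import Data.Fin.Subset using (Subset; inside; outside; ∁; ⊥)
open import Data.List.Base using (List; []; _∷_; _++_; map)
import Data.List.Extrema as Extrema
open import Data.List.Membership.Propositional using (_∈_)
open import Data.List.Membership.Propositional.Properties
  using (∈-map⁺; ∈-++⁺ˡ; ∈-++⁺ʳ)
open import Data.List.Relation.Unary.Any using (here)
open import Data.Nat.Base using (ℕ; zero; suc)
open import Data.Product.Base using (∃; _×_)
open import Data.Vec.Base as Vec using (lookup)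
open import Level using (Level; _⊔_) renaming (suc to lsuc)
open import Relation.Binary.Bundles using (DecTotalOrder)
open import Relation.Binary.Core using (Rel)
import Relation.Binary.Properties.DecTotalOrder as DecTotalOrderProperties
open import Relation.Binary.PropositionalEquality.Core using (_≡_; refl)
open import Relation.Binary.Structures using (IsDecTotalOrder)
open import Relation.Nullary.Decidable using (yes; no; does; ¬?; _×-dec_)
open import Relation.Nullary.Negation using (¬_)
open import Relation.Unary using (Pred; Satisfiable)
open import Relation.Binary.Definitions using (Decidable)

-- The real numbers, given by their characterisation (unique up to
-- isomorphism) as a Dedekind-complete totally ordered field.  The order is
-- decidable, as it is classically.
record CompleteOrderedField c ℓ₁ ℓ₂ : Set (lsuc (c ⊔ ℓ₁ ⊔ ℓ₂)) where
  infix  8 _⁻¹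
  infixl 7 _*_
  infixl 6 _+_
  infix  4 _≈_ _≤_
  field
    Carrier : Set c
    _≈_     : Rel Carrier ℓ₁
    _≤_     : Rel Carrier ℓ₂
    _+_ _*_ : Op₂ Carrier
    -_ _⁻¹  : Op₁ Carrier
    0# 1#   : Carrier

    isCommutativeRing : IsCommutativeRing _≈_ _+_ _*_ -_ 0# 1#
    isDecTotalOrder   : IsDecTotalOrder _≈_ _≤_

    0≉1        : ¬ 0# ≈ 1#
    -- The value of 0# ⁻¹ is unconstrained.
    *-inverseʳ : ∀ x → ¬ x ≈ 0# → x * x ⁻¹ ≈ 1#

    +-monoˡ-≤ : ∀ z {x y} → x ≤ y → x + z ≤ y + z
    *-nonneg  : ∀ {x y} → 0# ≤ x → 0# ≤ y → 0# ≤ x * y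

  commutativeRing : CommutativeRing c ℓ₁
  commutativeRing = record { isCommutativeRing = isCommutativeRing }

  decTotalOrder : DecTotalOrder c ℓ₁ ℓ₂
  decTotalOrder = record { isDecTotalOrder = isDecTotalOrder }

  open CommutativeRing commutativeRing public
    using (_-_; +-commutativeMonoid)
  open DecTotalOrder decTotalOrder public
    using (_≟_; _≤?_; totalOrder)
  open DecTotalOrderProperties decTotalOrder public
    using (_<_)

  infix 4 _<?_
  _<?_ : Decidable _<_
  x <? y = (x ≤? y) ×-dec ¬? (x ≟ y)

  UpperBound : ∀ {p} → Pred Carrier p → Pred Carrier _
  UpperBound S b = ∀ {x} → S x → x ≤ b

  -- Leastness of s is stated positively: every y < s is exceeded by a member
  -- of S.  Classically this says that no upper bound of S lies below s.
  Supremum : ∀ {p} → Pred Carrier p → Pred Carrier _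
  Supremum S s = UpperBound S s × (∀ {y} → y < s → ∃ λ x → S x × y < x)

  field
    complete : (S : Pred Carrier (c ⊔ ℓ₁ ⊔ ℓ₂)) →
               Satisfiable S → ∃ (UpperBound S) → ∃ (Supremum S)

  infixl 7 _/_
  _/_ : Op₂ Carrier
  x / y = x * y ⁻¹

  2# 3# 4# : Carrier
  2# = 1# + 1#
  3# = 2# + 1#
  4# = 3# + 1#

subsets : ∀ n → List (Subset n)
subsets zero    = Vec.[] ∷ []
subsets (suc n) = map (outside Vec.∷_) (subsets n) ++
                  map (inside  Vec.∷_) (subsets n)

∈-subsets : ∀ {n} (X : Subset n) → X ∈ subsets n
∈-subsets Vec.[]              = here refl
∈-subsets (outside Vec.∷ X) = ∈-++⁺ˡ (∈-map⁺ _ (∈-subsets X))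
∈-subsets {suc n} (inside Vec.∷ X) =
  ∈-++⁺ʳ (map (outside Vec.∷_) (subsets n)) (∈-map⁺ _ (∈-subsets X))

module WeightedDigraphs {c ℓ₁ ℓ₂} (ℝ : CompleteOrderedField c ℓ₁ ℓ₂) where
  open CompleteOrderedField ℝ
  open Sum +-commutativeMonoid using (sum-syntax)
  open Extrema totalOrder using (max)

  -- The vertex set is Fin order.  A Boolean arc relation has no parallel
  -- arcs, and the weight function is defined on the arcs only.
  record WeightedDigraph : Set (c ⊔ ℓ₂) where
    field
      order    : ℕ
      arc      : Fin order → Fin order → Bool
      loopless : ∀ v → arc v v ≡ false
      weight   : ∀ u v → T (arc u v) → Carrier
      nonneg   : ∀ u v (a : T (arc u v)) → 0# ≤ weight u v a

    -- Extended by zero to the pairs that are not arcs, for use in sums.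
    weight₀ : Fin order → Fin order → Carrier
    weight₀ u v with T? (arc u v)
    ... | yes a = weight u v a
    ... | no  _ = 0#

  module _ (D : WeightedDigraph) where
    open WeightedDigraph D

    totalWeight : Carrier
    totalWeight = ∑[ u < order ] ∑[ v < order ] weight₀ u v

    w⁺ w⁻ r : Fin order → Carrier
    w⁺ v = ∑[ u < order ] weight₀ v u
    w⁻ v = ∑[ u < order ] weight₀ u v
    r  v = w⁺ v - w⁻ v

    r⁺ : Carrier
    r⁺ = ∑[ v < order ] (if does (0# <? r v) then r v else 0#)

    -- Meaningful only if totalWeight is nonzero.
    θ[_] : Carrier
    θ[_] = r⁺ / totalWeight

    cutWeight : Subset order → Subset order → Carrier
    cutWeight X Y = ∑[ u < order ] ∑[ v < order ]
      (if lookup X u ∧ lookup Y v then weight₀ u v else 0#)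

    -- The partitions of the vertex set are the pairs (X , ∁ X).  A trivial
    -- part is allowed; such a partition has weight 0#, so it does not affect
    -- the maximum.
    mac : Carrier
    mac = max (cutWeight ⊥ (∁ ⊥))
              (map (λ X → cutWeight X (∁ X)) (subsets order))

  l : Carrier → Carrier
  l θ = if does (θ <? 1# / 3#)
        then 1# / 4# + (θ * θ) / (4# * (1# - 2# * θ))
        else θ

-- Take two bidirected complete digraphs on n vertices each, with uniform arc weight a,
-- and uniform arcs of weight b from the first to the second.  The inner arcs cancel in r,
-- so r⁺ = n² b.  With n = m + 1, a = (1 - θ) n and b = 2 θ m the total weight is 2 n² m and
-- the proportion θ is exact.  If the source part of a cut has i vertices in the first half
-- and misses k in the second, its weight is a (i (n - i) + k (n - k)) + b i k.  By
-- 2 i k ≤ i² + k² this is at most a sum of two quadratics, in i and in k, and each is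
-- maximised separately.  For θ ≤ 1/3 this bounds every cut by 2 n³ l(θ), which is n / m times
-- l(θ) w(D); for θ > 1/3 and large n we have a ≤ b and the maximum b n² is at i = k = n.
module Submission where

open import Defs
open import Algebra.Bundles using (CommutativeRing)
import Algebra.Properties.Group as GroupProperties
import Algebra.Properties.Semiring.Mult as Mult
import Algebra.Properties.Semiring.Sum as SemiringSum
import Algebra.Solver.Ring.NaturalCoefficients.Default as NatSolver
open import Data.Bool.Base using (Bool; true; false; T; not; _∧_; if_then_else_)
open import Data.Bool.Properties using (T?)
open import Data.Empty using (⊥-elim)
open import Data.Fin.Base using (Fin; zero; suc; _↑ˡ_; _↑ʳ_; splitAt; punchIn)
open import Data.Fin.Properties using (splitAt-↑ˡ; splitAt-↑ʳ; punchInᵢ≢i)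
  renaming (_≟_ to _≟ᶠ_)
open import Data.Fin.Subset using (Subset; ∁; ⊥)
import Data.List.Extrema as Extrema
import Data.List.Relation.Unary.All as All
import Data.List.Relation.Unary.All.Properties as All
open import Data.List.Membership.Propositional.Properties using (∈-map⁺)
open import Data.Nat.Base as ℕ using (ℕ; zero; suc)
open import Data.Product.Base using (_×_; ∃; _,_; proj₁; proj₂)
open import Data.Sum.Base using (_⊎_; inj₁; inj₂; [_,_]′)
open import Data.Vec.Base using (lookup; tabulate)
open import Data.Vec.Properties using (lookup-map; lookup∘tabulate)
open import Function.Base using (_∘_; const)
open import Level using (_⊔_; Lift; lift)
open import Relation.Binary.Bundles using (DecTotalOrder)
open import Relation.Binary.PropositionalEquality.Core as ≡ using (_≡_; _≢_)
import Relation.Binary.Properties.DecTotalOrder as DecTotalOrderProperties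
import Relation.Binary.Reasoning.PartialOrder as PartialOrderReasoning
open import Relation.Nullary.Decidable using (yes; no; does; toSum; dec-true; dec-false)
open import Relation.Nullary.Negation using (¬_; contradiction)

-- Ordered-field arithmetic, elementary quadratic inequalities and the Archimedean property.

module OrderedField {c ℓ₁ ℓ₂} (ℝ : CompleteOrderedField c ℓ₁ ℓ₂) where
  open CompleteOrderedField ℝ
  open CommutativeRing commutativeRing
    using ( refl; sym; +-congˡ; +-congʳ; +-comm; +-identityˡ; +-identityʳ; -‿inverseʳ
          ; *-cong; *-congˡ; *-congʳ; *-comm; *-identityˡ; *-identityʳ; zeroˡ; zeroʳ
          ; distribˡ; semiring; commutativeSemiring; +-group)
  open DecTotalOrder decTotalOrder using (poset; total; ≤-respˡ-≈)
    renaming (refl to ≤-refl; trans to ≤-trans)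
  open DecTotalOrderProperties decTotalOrder
    using (<⇒≉; <⇒≱; ≰⇒>; ≮⇒≥; <-respˡ-≈; <-respʳ-≈)
  open GroupProperties +-group using () renaming (∙-cancelʳ to +-cancelʳ)
  open NatSolver commutativeSemiring using (solve; _:=_; _:+_; _:*_; con)
  open PartialOrderReasoning poset

  x+[y-x]≈y : ∀ x y → x + (y - x) ≈ y
  x+[y-x]≈y x y = begin-equality
    x + (y - x) ≈⟨ solve 3 (λ x y z → x :+ (y :+ z) := y :+ (x :+ z)) refl x y (- x) ⟩
    y + (x - x) ≈⟨ +-congˡ (-‿inverseʳ x) ⟩
    y + 0#      ≈⟨ +-identityʳ y ⟩
    y           ∎

  x≤y⇒0≤y-x : ∀ {x y} → x ≤ y → 0# ≤ y - x
  x≤y⇒0≤y-x {x} x≤y = ≤-respˡ-≈ (-‿inverseʳ x) (+-monoˡ-≤ (- x) x≤y)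

  -- Turns an inequality into an equation without subtraction, a form that the solver for
  -- commutative semirings can work with.
  ≤-difference : ∀ {x y} → x ≤ y → ∃ λ d → 0# ≤ d × y ≈ x + d
  ≤-difference {x} {y} x≤y = y - x , x≤y⇒0≤y-x x≤y , sym (x+[y-x]≈y x y)

  x≤x+nonneg : ∀ x {d} → 0# ≤ d → x ≤ x + d
  x≤x+nonneg x {d} 0≤d = begin
    x      ≈⟨ +-identityˡ x ⟨
    0# + x ≤⟨ +-monoˡ-≤ x 0≤d ⟩
    d + x  ≈⟨ +-comm d x ⟩
    x + d  ∎

  +-monoʳ-≤ : ∀ z {x y} → x ≤ y → z + x ≤ z + y
  +-monoʳ-≤ z {x} {y} x≤y = begin
    z + x ≈⟨ +-comm z x ⟩
    x + z ≤⟨ +-monoˡ-≤ z x≤y ⟩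
    y + z ≈⟨ +-comm y z ⟩
    z + y ∎

  +-mono-≤ : ∀ {w x y z} → w ≤ x → y ≤ z → w + y ≤ x + z
  +-mono-≤ {w} {x} {y} {z} w≤x y≤z = ≤-trans (+-monoˡ-≤ y w≤x) (+-monoʳ-≤ x y≤z)

  +-monoˡ-< : ∀ z {x y} → x < y → x + z < y + z
  +-monoˡ-< z {x} {y} (x≤y , x≉y) = +-monoˡ-≤ z x≤y , x≉y ∘ +-cancelʳ z x y

  x<y⇒0<y-x : ∀ {x y} → x < y → 0# < y - x
  x<y⇒0<y-x {x} x<y = <-respˡ-≈ (-‿inverseʳ x) (+-monoˡ-< (- x) x<y)

  +-nonneg : ∀ {x y} → 0# ≤ x → 0# ≤ y → 0# ≤ x + y
  +-nonneg {x} 0≤x 0≤y = ≤-trans 0≤x (x≤x+nonneg x 0≤y)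

  *-monoˡ-≤ : ∀ {p} → 0# ≤ p → ∀ {x y} → x ≤ y → p * x ≤ p * y
  *-monoˡ-≤ {p} 0≤p {x} {y} x≤y with d , 0≤d , y≈x+d ← ≤-difference x≤y = begin
    p * x         ≤⟨ x≤x+nonneg (p * x) (*-nonneg 0≤p 0≤d) ⟩
    p * x + p * d ≈⟨ distribˡ p x d ⟨
    p * (x + d)   ≈⟨ *-congˡ y≈x+d ⟨
    p * y         ∎

  *-monoʳ-≤ : ∀ {p} → 0# ≤ p → ∀ {x y} → x ≤ y → x * p ≤ y * p
  *-monoʳ-≤ {p} 0≤p {x} {y} x≤y = begin
    x * p ≈⟨ *-comm x p ⟩
    p * x ≤⟨ *-monoˡ-≤ 0≤p x≤y ⟩
    p * y ≈⟨ *-comm p y ⟩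
    y * p ∎

  *-cancelˡ : ∀ {p} → ¬ p ≈ 0# → ∀ {x y} → p * x ≈ p * y → x ≈ y
  *-cancelˡ {p} p≉0 {x} {y} px≈py = begin-equality
    x              ≈⟨ undo x ⟨
    p ⁻¹ * (p * x) ≈⟨ *-congˡ px≈py ⟩
    p ⁻¹ * (p * y) ≈⟨ undo y ⟩
    y              ∎
    where
    undo : ∀ z → p ⁻¹ * (p * z) ≈ z
    undo z = begin-equality
      p ⁻¹ * (p * z) ≈⟨ solve 3 (λ p q z → q :* (p :* z) := p :* q :* z) refl p (p ⁻¹) z ⟩
      p * p ⁻¹ * z   ≈⟨ *-congʳ (*-inverseʳ p p≉0) ⟩
      1# * z         ≈⟨ *-identityˡ z ⟩
      z              ∎

  pos⇒nonzero : ∀ {x} → 0# < x → ¬ x ≈ 0#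
  pos⇒nonzero 0<x = <⇒≉ 0<x ∘ sym

  *-monoˡ-< : ∀ {p} → 0# < p → ∀ {x y} → x < y → p * x < p * y
  *-monoˡ-< 0<p (x≤y , x≉y) =
    *-monoˡ-≤ (proj₁ 0<p) x≤y , x≉y ∘ *-cancelˡ (pos⇒nonzero 0<p)

  *-cancelˡ-< : ∀ {p} → 0# ≤ p → ∀ {x y} → p * x < p * y → x < y
  *-cancelˡ-< 0≤p px<py = ≰⇒> λ y≤x → <⇒≱ px<py (*-monoˡ-≤ 0≤p y≤x)

  *-cancelˡ-≤ : ∀ {p} → 0# < p → ∀ {x y} → p * x ≤ p * y → x ≤ y
  *-cancelˡ-≤ 0<p px≤py = ≮⇒≥ λ y<x → <⇒≱ (*-monoˡ-< 0<p y<x) px≤py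

  *-pos : ∀ {x y} → 0# < x → 0# < y → 0# < x * y
  *-pos {x} 0<x 0<y = <-respˡ-≈ (zeroʳ x) (*-monoˡ-< 0<x 0<y)

  y*[x/y]≈x : ∀ {x y} → 0# < y → y * (x / y) ≈ x
  y*[x/y]≈x {x} {y} 0<y = begin-equality
    y * (x * y ⁻¹) ≈⟨ solve 3 (λ x y z → y :* (x :* z) := x :* (y :* z)) refl x y (y ⁻¹) ⟩
    x * (y * y ⁻¹) ≈⟨ *-congˡ (*-inverseʳ y (pos⇒nonzero 0<y)) ⟩
    x * 1#         ≈⟨ *-identityʳ x ⟩
    x              ∎

  +-pos : ∀ {x y} → 0# < x → 0# ≤ y → 0# < x + y
  +-pos {x} {y} 0<x 0≤y = begin-strict
    0#    <⟨ 0<x ⟩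
    x     ≤⟨ x≤x+nonneg x 0≤y ⟩
    x + y ∎

  0≤1 : 0# ≤ 1#
  0≤1 with total 0# 1#
  ... | inj₁ 0≤1 = 0≤1
  -- Here `1# + d` vanishes, so `d` plays the part of -1 and its nonnegative square equals `1#`.
  ... | inj₂ 1≤0 with d , 0≤d , 0≈1+d ← ≤-difference 1≤0 = begin
    0#               ≤⟨ *-nonneg 0≤d 0≤d ⟩
    d * d            ≈⟨ +-identityˡ (d * d) ⟨
    0# + d * d       ≈⟨ +-congʳ 0≈1+d ⟩
    1# + d + d * d   ≈⟨ solve 1 (λ d → con 1 :+ d :+ d :* d := con 1 :+ (con 1 :+ d) :* d) refl d ⟩
    1# + (1# + d) * d ≈⟨ +-congˡ (*-congʳ 0≈1+d) ⟨
    1# + 0# * d      ≈⟨ +-congˡ (zeroˡ d) ⟩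
    1# + 0#          ≈⟨ +-identityʳ 1# ⟩
    1#               ∎

  0<1 : 0# < 1#
  0<1 = 0≤1 , 0≉1

  0<2 : 0# < 2#
  0<2 = +-pos 0<1 0≤1

  0<3 : 0# < 3#
  0<3 = +-pos 0<2 0≤1

  0<4 : 0# < 4#
  0<4 = +-pos 0<3 0≤1

  -- The two sides differ by the square of `d`, the difference of `y` and `x`; writing `y` as
  -- `x + d` keeps the identity within semiring terms.
  x≤y⇒2xy≤x²+y² : ∀ {x y} → x ≤ y → 2# * (x * y) ≤ x * x + y * y
  x≤y⇒2xy≤x²+y² {x} {y} x≤y with d , 0≤d , y≈x+d ← ≤-difference x≤y = begin
    2# * (x * y)                ≈⟨ *-congˡ (*-congˡ y≈x+d) ⟩
    2# * (x * (x + d))          ≤⟨ x≤x+nonneg _ (*-nonneg 0≤d 0≤d) ⟩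
    2# * (x * (x + d)) + d * d  ≈⟨ solve 2 (λ x d → con 2 :* (x :* (x :+ d)) :+ d :* d
                                     := x :* x :+ (x :+ d) :* (x :+ d)) refl x d ⟩
    x * x + (x + d) * (x + d)   ≈⟨ +-congˡ (*-cong y≈x+d y≈x+d) ⟨
    x * x + y * y               ∎

  2xy≤x²+y² : ∀ x y → 2# * (x * y) ≤ x * x + y * y
  2xy≤x²+y² x y with total x y
  ... | inj₁ x≤y = x≤y⇒2xy≤x²+y² x≤y
  ... | inj₂ y≤x = begin
    2# * (x * y)   ≈⟨ *-congˡ (*-comm x y) ⟩
    2# * (y * x)   ≤⟨ x≤y⇒2xy≤x²+y² y≤x ⟩
    y * y + x * x  ≈⟨ +-comm (y * y) (x * x) ⟩
    x * x + y * y  ∎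

  4xy≤[x+y]² : ∀ x y → 4# * (x * y) ≤ (x + y) * (x + y)
  4xy≤[x+y]² x y = begin
    4# * (x * y)                      ≈⟨ solve 2 (λ x y → con 4 :* (x :* y)
                                           := con 2 :* (x :* y) :+ con 2 :* (x :* y)) refl x y ⟩
    2# * (x * y) + 2# * (x * y)       ≤⟨ +-monoˡ-≤ _ (2xy≤x²+y² x y) ⟩
    x * x + y * y + 2# * (x * y)      ≈⟨ solve 2 (λ x y → x :* x :+ y :* y :+ con 2 :* (x :* y)
                                           := (x :+ y) :* (x :+ y)) refl x y ⟩
    (x + y) * (x + y)                 ∎

  open Mult semiring using () renaming (_×_ to _·_)

  ι : ℕ → Carrier
  ι n = n · 1#

  ι-nonneg : ∀ n → 0# ≤ ι n
  ι-nonneg zero    = ≤-refl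
  ι-nonneg (suc n) = +-nonneg 0≤1 (ι-nonneg n)

  ι-pos : ∀ n → 0# < ι (suc n)
  ι-pos n = +-pos 0<1 (ι-nonneg n)

  -- Let `s` be the supremum of the multiples of `ε` not exceeding `x`. Some such multiple exceeds
  -- `s - ε`, so the next one exceeds `s` and therefore `x`. The index is a successor because `n`
  -- later serves as `m′`, with `M` equal to `ι (suc m′)` and required to be positive.
  archimedean : ∀ x {ε} → 0# < ε → ∃ λ n → x < ι (suc n) * ε
  archimedean x {ε} 0<ε with total 0# x
  ... | inj₂ x≤0 = 0 , (begin-strict
    x          ≤⟨ x≤0 ⟩
    0#         <⟨ *-pos (ι-pos 0) 0<ε ⟩
    ι 1 * ε    ∎)
  ... | inj₁ 0≤x =
    let _ , lift (n , y≈nε , _) , s-ε<y = exceed s-ε<s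
    in n , ≰⇒> λ 1+n≤x →
         <⇒≱ (s<1+n n (<-respʳ-≈ y≈nε s-ε<y)) (bound (lift (suc n , refl , 1+n≤x)))
    where
    -- The bound by `x` makes the set bounded above, and `0# ≤ x` puts the zeroth multiple into it;
    -- for negative `x` it would be empty, hence the separate case. `Lift` only raises the predicate
    -- to the level that `complete` expects.
    Multiple : Carrier → Set (c ⊔ ℓ₁ ⊔ ℓ₂)
    Multiple y = Lift c (∃ λ n → y ≈ ι n * ε × ι n * ε ≤ x)

    supremum : ∃ (Supremum Multiple)
    supremum = complete Multiple
      (0# , lift (0 , sym (zeroˡ ε) , ≤-respˡ-≈ (sym (zeroˡ ε)) 0≤x))
      (x , λ { (lift (_ , y≈nε , nε≤x)) → ≤-respˡ-≈ (sym y≈nε) nε≤x })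

    s = proj₁ supremum
    bound = proj₁ (proj₂ supremum)
    exceed = proj₂ (proj₂ supremum)

    s-ε+ε≈s : s - ε + ε ≈ s
    s-ε+ε≈s = begin-equality
      s - ε + ε    ≈⟨ +-comm (s - ε) ε ⟩
      ε + (s - ε)  ≈⟨ x+[y-x]≈y ε s ⟩
      s            ∎

    s-ε<s : s - ε < s
    s-ε<s = begin-strict
      s - ε        ≈⟨ +-identityˡ _ ⟨
      0# + (s - ε) <⟨ +-monoˡ-< (s - ε) 0<ε ⟩
      ε + (s - ε)  ≈⟨ x+[y-x]≈y ε s ⟩
      s            ∎

    s<1+n : ∀ n → s - ε < ι n * ε → s < ι (suc n) * ε
    s<1+n n s-ε<nε = begin-strict
      s               ≈⟨ s-ε+ε≈s ⟨
      s - ε + ε       <⟨ +-monoˡ-< ε s-ε<nε ⟩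
      ι n * ε + ε     ≈⟨ solve 2 (λ n e → n :* e :+ e := (con 1 :+ n) :* e) refl (ι n) ε ⟩
      ι (suc n) * ε   ∎

-- Finite sums, indicator counts and sums over a vertex set with two sides.

module Sums {c ℓ₁ ℓ₂} (ℝ : CompleteOrderedField c ℓ₁ ℓ₂) where
  open CompleteOrderedField ℝ
  open CommutativeRing commutativeRing
    using ( sym; trans; +-cong; +-congˡ; +-congʳ; +-assoc; +-comm; +-identityˡ
          ; *-congʳ; *-identityˡ; semiring; setoid)
  open DecTotalOrder decTotalOrder using () renaming (refl to ≤-refl)
  open OrderedField ℝ using (ι; +-nonneg; 0≤1)
  open SemiringSum semiring public
  open import Relation.Binary.Reasoning.Setoid setoid

  sum-splitAt : ∀ m {n} (f : Fin (m ℕ.+ n) → Carrier) →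
                sum f ≈ sum (λ i → f (i ↑ˡ n)) + sum (λ j → f (m ↑ʳ j))
  sum-splitAt zero    f = sym (+-identityˡ (sum f))
  sum-splitAt (suc m) f = trans (+-congˡ (sum-splitAt m (f ∘ suc))) (sym (+-assoc _ _ _))

  sum-nonneg : ∀ {n} (f : Fin n → Carrier) → (∀ i → 0# ≤ f i) → 0# ≤ sum f
  sum-nonneg {zero}  f 0≤f = ≤-refl
  sum-nonneg {suc n} f 0≤f = +-nonneg (0≤f zero) (sum-nonneg (f ∘ suc) (0≤f ∘ suc))

  -- Meant for a row or column of arc weights: `f` vanishes at the loop `k`, while `g` fills the
  -- loop in and so depends on sides alone, which makes its sum easy.
  sum-except : ∀ {n} {f g : Fin (suc n) → Carrier} k → f k ≈ 0# →
               (∀ i → i ≢ k → f i ≈ g i) → sum f + g k ≈ sum g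
  sum-except {n} {f} {g} k fk≈0 f≈g = begin
    sum f + g k         ≈⟨ +-congʳ (sum-remove f) ⟩
    f k + rest f + g k  ≈⟨ +-congʳ (+-congʳ fk≈0) ⟩
    0# + rest f + g k   ≈⟨ +-congʳ (+-identityˡ (rest f)) ⟩
    rest f + g k        ≈⟨ +-congʳ (sum-cong-≋ λ i → f≈g (punchIn k i) (punchInᵢ≢i k i)) ⟩
    rest g + g k        ≈⟨ +-comm (rest g) (g k) ⟩
    g k + rest g        ≈⟨ sum-remove g ⟨
    sum g               ∎
    where
    rest : (Fin (suc n) → Carrier) → Carrier
    rest h = ∑[ i < n ] h (punchIn k i)

  indicator : Bool → Carrier
  indicator b = if b then 1# else 0#

  indicator-nonneg : ∀ b → 0# ≤ indicator b
  indicator-nonneg true  = 0≤1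
  indicator-nonneg false = ≤-refl

  sum-indicator-nonneg : ∀ {n} (b : Fin n → Bool) → 0# ≤ ∑[ i < n ] indicator (b i)
  sum-indicator-nonneg b = sum-nonneg (indicator ∘ b) (indicator-nonneg ∘ b)

  sum-indicator-complement : ∀ {n} (b : Fin n → Bool) →
    ∑[ i < n ] indicator (b i) + ∑[ i < n ] indicator (not (b i)) ≈ ι n
  sum-indicator-complement {n} b = begin
    ∑[ i < n ] indicator (b i) + ∑[ i < n ] indicator (not (b i))
      ≈⟨ ∑-distrib-+ (indicator ∘ b) (indicator ∘ not ∘ b) ⟨
    ∑[ i < n ] (indicator (b i) + indicator (not (b i)))
      ≈⟨ sum-cong-≋ (λ i → complementary (b i)) ⟩
    ∑[ i < n ] 1#
      ≈⟨ sum-replicate n ⟩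
    ι n ∎
    where
    complementary : ∀ b → indicator b + indicator (not b) ≈ 1#
    complementary true  = trans (+-comm 1# 0#) (+-identityˡ 1#)
    complementary false = +-identityˡ 1#

  -- The first n of the n + n vertices form one side, the last n the other.
  module Sides (n : ℕ) where
    side : Fin (n ℕ.+ n) → Bool
    side u = [ const true , const false ]′ (splitAt n u)

    side-↑ˡ : ∀ i → side (i ↑ˡ n) ≡ true
    side-↑ˡ i = ≡.cong [ const true , const false ]′ (splitAt-↑ˡ n i n)

    side-↑ʳ : ∀ i → side (n ↑ʳ i) ≡ false
    side-↑ʳ i = ≡.cong [ const true , const false ]′ (splitAt-↑ʳ n n i)

    sumˡ sumʳ : (Fin (n ℕ.+ n) → Carrier) → Carrier
    sumˡ f = ∑[ i < n ] f (i ↑ˡ n)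
    sumʳ f = ∑[ i < n ] f (n ↑ʳ i)

    -- On each half `h` is constant and factors out of the sum. With `p` the indicator of a part of
    -- a cut, the remaining sums are vertex counts.
    sum-sides : ∀ p (h : Bool → Carrier) →
                ∑[ u < n ℕ.+ n ] (p u * h (side u)) ≈ sumˡ p * h true + sumʳ p * h false
    sum-sides p h = begin
      ∑[ u < n ℕ.+ n ] (p u * h (side u))
        ≈⟨ sum-splitAt n (λ u → p u * h (side u)) ⟩
      sumˡ (λ u → p u * h (side u)) + sumʳ (λ u → p u * h (side u))
        ≡⟨ ≡.cong₂ _+_
             (sum-cong-≗ λ i → ≡.cong (λ s → p (i ↑ˡ n) * h s) (side-↑ˡ i))
             (sum-cong-≗ λ i → ≡.cong (λ s → p (n ↑ʳ i) * h s) (side-↑ʳ i)) ⟩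
      ∑[ i < n ] (p (i ↑ˡ n) * h true) + ∑[ i < n ] (p (n ↑ʳ i) * h false)
        ≈⟨ +-cong (*-distribʳ-sum (h true) (λ i → p (i ↑ˡ n)))
                  (*-distribʳ-sum (h false) (λ i → p (n ↑ʳ i))) ⟨
      sumˡ p * h true + sumʳ p * h false ∎

    sum-by-side : ∀ {f : Fin (n ℕ.+ n) → Carrier} (h : Bool → Carrier) →
                  (∀ u → f u ≈ h (side u)) →
                  ∑[ u < n ℕ.+ n ] f u ≈ ι n * h true + ι n * h false
    sum-by-side {f} h f≈h = begin
      ∑[ u < n ℕ.+ n ] f u
        ≈⟨ sum-cong-≋ (λ u → trans (f≈h u) (sym (*-identityˡ (h (side u))))) ⟩
      ∑[ u < n ℕ.+ n ] (1# * h (side u))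
        ≈⟨ sum-sides (const 1#) h ⟩
      sumˡ (const 1#) * h true + sumʳ (const 1#) * h false
        ≈⟨ +-cong (*-congʳ (sum-replicate n)) (*-congʳ (sum-replicate n)) ⟩
      ι n * h true + ι n * h false ∎

-- Auxiliary facts on maximum cuts, positive parts and indicators.

module TwoCliques {c ℓ₁ ℓ₂} (ℝ : CompleteOrderedField c ℓ₁ ℓ₂) where
  open CompleteOrderedField ℝ
  open WeightedDigraphs ℝ
  open CommutativeRing commutativeRing
    using ( refl; sym; trans; +-cong; +-congˡ; +-congʳ; +-comm; +-identityʳ; -‿inverseʳ
          ; *-cong; *-congˡ; zeroˡ; commutativeSemiring; +-group; setoid)
    renaming (reflexive to ≡⇒≈)
  open DecTotalOrder decTotalOrder using (antisym)
    renaming (refl to ≤-refl; reflexive to ≤-reflexive; trans to ≤-trans)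
  open OrderedField ℝ
  open Sums ℝ
  open Extrema totalOrder using (max<v⁺; max≈v⁺)
  open GroupProperties +-group using () renaming (∙-cancelʳ to +-cancelʳ)
  open NatSolver commutativeSemiring using (solve; _:=_; _:+_; _:*_; con)
  open import Relation.Binary.Reasoning.Setoid setoid

  -- `max` has a default value besides the list; in `mac` it is the cut at `⊥`, so a bound on all
  -- cuts covers it too.
  mac-< : ∀ D {x} → (∀ X → cutWeight D X (∁ X) < x) → mac D < x
  mac-< D cut<x = max<v⁺ (cut<x ⊥) (All.map⁺ (All.universal cut<x (subsets _)))

  mac-≈ : ∀ D X₀ → (∀ X → cutWeight D X (∁ X) ≤ cutWeight D X₀ (∁ X₀)) →
          mac D ≈ cutWeight D X₀ (∁ X₀)
  mac-≈ D X₀ cut≤ = max≈v⁺ (∈-map⁺ _ (∈-subsets X₀))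
    (All.map⁺ (All.universal cut≤ (subsets _))) (cut≤ ⊥)

  positivePart : Carrier → Carrier
  positivePart x = if does (0# <? x) then x else 0#

  -- `0# <? x` is built from the tests `0# ≤? x` and `0# ≟ x`, so matching on both lets the
  -- conditional compute. When `x` is zero the test fails, but the value `0#` is still `x`.
  nonneg⇒positivePart : ∀ {x} → 0# ≤ x → positivePart x ≈ x
  nonneg⇒positivePart {x} 0≤x with 0# ≤? x | 0# ≟ x
  ... | yes _   | yes 0≈x = 0≈x
  ... | yes _   | no  _   = refl
  ... | no  0≰x | _       = contradiction 0≤x 0≰x

  nonpos⇒positivePart : ∀ {x} → x ≤ 0# → positivePart x ≈ 0#
  nonpos⇒positivePart {x} x≤0 with 0# ≤? x | 0# ≟ x
  ... | yes _   | yes _   = refl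
  ... | yes 0≤x | no  0≉x = contradiction (antisym 0≤x x≤0) 0≉x
  ... | no  _   | _       = refl

  x≈y+z⇒x-y≈z : ∀ {x y z} → x ≈ y + z → x - y ≈ z
  x≈y+z⇒x-y≈z {x} {y} {z} x≈y+z = begin
    x - y       ≈⟨ +-congʳ x≈y+z ⟩
    y + z - y   ≈⟨ solve 3 (λ y z w → y :+ z :+ w := z :+ (y :+ w)) refl y z (- y) ⟩
    z + (y - y) ≈⟨ +-congˡ (-‿inverseʳ y) ⟩
    z + 0#      ≈⟨ +-identityʳ z ⟩
    z           ∎

  y≈x+z⇒x-y+z≈0 : ∀ {x y z} → y ≈ x + z → x - y + z ≈ 0#
  y≈x+z⇒x-y+z≈0 {x} {y} {z} y≈x+z = begin
    x - y + z   ≈⟨ solve 3 (λ x z w → x :+ w :+ z := x :+ z :+ w) refl x z (- y) ⟩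
    x + z - y   ≈⟨ +-congʳ y≈x+z ⟨
    y - y       ≈⟨ -‿inverseʳ y ⟩
    0#          ∎

  if-∧ : ∀ p q x → (if p ∧ q then x else 0#) ≈ indicator p * (indicator q * x)
  if-∧ true  true  x = solve 1 (λ x → x := con 1 :* (con 1 :* x)) refl x
  if-∧ true  false x = solve 1 (λ x → con 0 := con 1 :* (con 0 :* x)) refl x
  if-∧ false q     x = sym (zeroˡ (indicator q * x))

  indicator-disjoint : ∀ p x → indicator p * (indicator (not p) * x) ≈ 0#
  indicator-disjoint true  x = solve 1 (λ x → con 1 :* (con 0 :* x) := con 0) refl x
  indicator-disjoint false x = zeroˡ (1# * x)

  -- Degrees and total weight of the two-clique digraph.

  module _ (m : ℕ) {a b : Carrier} (0≤a : 0# ≤ a) (0≤b : 0# ≤ b) where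
    private
      n : ℕ
      n = suc m

    open Sides n

    -- The arcs from the second side back to the first are present, with weight 0#.
    sideWeight : Bool → Bool → Carrier
    sideWeight true  true  = a
    sideWeight true  false = b
    sideWeight false true  = 0#
    sideWeight false false = a

    sideWeight-nonneg : ∀ s t → 0# ≤ sideWeight s t
    sideWeight-nonneg true  true  = 0≤a
    sideWeight-nonneg true  false = 0≤b
    sideWeight-nonneg false true  = ≤-refl
    sideWeight-nonneg false false = 0≤a

    sideWeight-diagonal : ∀ s → sideWeight s s ≡ a
    sideWeight-diagonal true  = ≡.refl
    sideWeight-diagonal false = ≡.refl

    D : WeightedDigraph
    D = record
      { order    = n ℕ.+ n
      ; arc      = λ u v → not (does (u ≟ᶠ v))
      ; loopless = λ v → ≡.cong not (dec-true (v ≟ᶠ v) ≡.refl)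
      ; weight   = λ u v _ → sideWeight (side u) (side v)
      ; nonneg   = λ u v _ → sideWeight-nonneg (side u) (side v)
      }

    open WeightedDigraph D using (arc; loopless; weight₀)

    weight₀-loop : ∀ v → weight₀ v v ≡ 0#
    weight₀-loop v with T? (arc v v)
    ... | yes t = ⊥-elim (≡.subst T (loopless v) t)
    ... | no  _ = ≡.refl

    weight₀-arc : ∀ {u v} → u ≢ v → weight₀ u v ≡ sideWeight (side u) (side v)
    weight₀-arc {u} {v} u≢v with T? (arc u v)
    ... | yes _  = ≡.refl
    ... | no  ¬t = contradiction (≡.subst T (≡.sym arc-true) _) ¬t
      where
      arc-true : arc u v ≡ true
      arc-true = ≡.cong not (dec-false (u ≟ᶠ v) u≢v)

    -- A vertex has `m` neighbours in its own clique, one fewer than the clique has vertices, and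
    -- `n` in the other. The inner contributions to the two degrees are equal, which is why only
    -- `ι n * b` survives in `netWeight⁺`.
    outWeight inWeight netWeight⁺ : Bool → Carrier
    outWeight true  = ι m * a + ι n * b
    outWeight false = ι m * a
    inWeight true  = ι m * a
    inWeight false = ι m * a + ι n * b
    netWeight⁺ true  = ι n * b
    netWeight⁺ false = 0#

    -- Adding the missing loop weight `a` to both sides completes the row, which then has a constant
    -- entry on each side; `a` is cancelled at the end.
    w⁺-by-side : ∀ v → w⁺ D v ≈ outWeight (side v)
    w⁺-by-side v = +-cancelʳ a (w⁺ D v) (outWeight (side v)) (begin
      w⁺ D v + a
        ≡⟨ ≡.cong (w⁺ D v +_) (sideWeight-diagonal (side v)) ⟨
      w⁺ D v + sideWeight (side v) (side v)
        ≈⟨ sum-except v (≡⇒≈ (weight₀-loop v)) (λ u u≢v → ≡⇒≈ (weight₀-arc (u≢v ∘ ≡.sym))) ⟩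
      ∑[ u < n ℕ.+ n ] sideWeight (side v) (side u)
        ≈⟨ sum-by-side (sideWeight (side v)) (λ _ → refl) ⟩
      ι n * sideWeight (side v) true + ι n * sideWeight (side v) false
        ≈⟨ row (side v) ⟩
      outWeight (side v) + a ∎)
      where
      row : ∀ s → ι n * sideWeight s true + ι n * sideWeight s false ≈ outWeight s + a
      row true  = solve 3 (λ m a b → (con 1 :+ m) :* a :+ (con 1 :+ m) :* b
                                  := m :* a :+ (con 1 :+ m) :* b :+ a) refl (ι m) a b
      row false = solve 2 (λ m a → (con 1 :+ m) :* con 0 :+ (con 1 :+ m) :* a
                                := m :* a :+ a) refl (ι m) a

    w⁻-by-side : ∀ v → w⁻ D v ≈ inWeight (side v)
    w⁻-by-side v = +-cancelʳ a (w⁻ D v) (inWeight (side v)) (begin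
      w⁻ D v + a
        ≡⟨ ≡.cong (w⁻ D v +_) (sideWeight-diagonal (side v)) ⟨
      w⁻ D v + sideWeight (side v) (side v)
        ≈⟨ sum-except v (≡⇒≈ (weight₀-loop v)) (λ u u≢v → ≡⇒≈ (weight₀-arc u≢v)) ⟩
      ∑[ u < n ℕ.+ n ] sideWeight (side u) (side v)
        ≈⟨ sum-by-side (λ s → sideWeight s (side v)) (λ _ → refl) ⟩
      ι n * sideWeight true (side v) + ι n * sideWeight false (side v)
        ≈⟨ column (side v) ⟩
      inWeight (side v) + a ∎)
      where
      column : ∀ s → ι n * sideWeight true s + ι n * sideWeight false s ≈ inWeight s + a
      column true  = solve 2 (λ m a → (con 1 :+ m) :* a :+ (con 1 :+ m) :* con 0
                                   := m :* a :+ a) refl (ι m) a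
      column false = solve 3 (λ m a b → (con 1 :+ m) :* b :+ (con 1 :+ m) :* a
                                     := m :* a :+ (con 1 :+ m) :* b :+ a) refl (ι m) a b

    0≤nb : 0# ≤ ι n * b
    0≤nb = *-nonneg (ι-nonneg n) 0≤b

    positivePart-r : ∀ v → positivePart (r D v) ≈ netWeight⁺ (side v)
    positivePart-r v with side v | w⁺-by-side v | w⁻-by-side v
    ... | true  | out | in′ =
      trans (nonneg⇒positivePart (≤-trans 0≤nb (≤-reflexive (sym r≈nb)))) r≈nb
      where
      r≈nb : r D v ≈ ι n * b
      r≈nb = x≈y+z⇒x-y≈z (trans out (+-congʳ (sym in′)))
    -- On the second side `r D v + ι n * b` vanishes, and adding a nonnegative amount to `r D v` can
    -- only increase it.
    ... | false | out | in′ = nonpos⇒positivePart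
      (≤-trans (x≤x+nonneg (r D v) 0≤nb)
        (≤-reflexive (y≈x+z⇒x-y+z≈0 (trans in′ (+-congʳ (sym out))))))

    r⁺-value : r⁺ D ≈ ι n * ι n * b
    r⁺-value = trans (sum-by-side netWeight⁺ positivePart-r)
      (solve 2 (λ n b → n :* (n :* b) :+ n :* con 0 := n :* n :* b) refl (ι n) b)

    totalWeight-value : totalWeight D ≈ ι n * (2# * (ι m * a) + ι n * b)
    totalWeight-value = trans (sum-by-side outWeight w⁺-by-side)
      (solve 4 (λ n m a b → n :* (m :* a :+ n :* b) :+ n :* (m :* a)
                         := n :* (con 2 :* (m :* a) :+ n :* b)) refl (ι n) (ι m) a b)

    -- Cut weights of the two-clique digraph.

    module Cut (X : Subset (n ℕ.+ n)) where
      χ χᶜ : Fin (n ℕ.+ n) → Carrier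
      χ  u = indicator (lookup X u)
      χᶜ u = indicator (not (lookup X u))

      -- Brings the summand into product form: one indicator for the tail, one for the head, and a
      -- weight that sees only sides. The double sum then factors.
      cut-term : ∀ u v →
        (if lookup X u ∧ lookup (∁ X) v then weight₀ u v else 0#) ≈
        χ u * (χᶜ v * sideWeight (side u) (side v))
      cut-term u v = begin
        (if lookup X u ∧ lookup (∁ X) v then weight₀ u v else 0#)
          ≡⟨ ≡.cong (λ t → if lookup X u ∧ t then weight₀ u v else 0#) (lookup-map v not X) ⟩
        (if lookup X u ∧ not (lookup X v) then weight₀ u v else 0#)
          ≈⟨ if-∧ (lookup X u) (not (lookup X v)) (weight₀ u v) ⟩
        χ u * (χᶜ v * weight₀ u v)
          ≈⟨ extend (toSum (u ≟ᶠ v)) ⟩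
        χ u * (χᶜ v * sideWeight (side u) (side v)) ∎
        where
        -- A loop never crosses the cut, so the missing loops may be given any weight.
        extend : u ≡ v ⊎ u ≢ v →
                 χ u * (χᶜ v * weight₀ u v) ≈
                 χ u * (χᶜ v * sideWeight (side u) (side v))
        extend (inj₁ ≡.refl) = trans (indicator-disjoint (lookup X u) _)
                                     (sym (indicator-disjoint (lookup X u) _))
        extend (inj₂ u≢v)    = *-congˡ (*-congˡ (≡⇒≈ (weight₀-arc u≢v)))

      xˡ xʳ : Fin n → Bool
      xˡ u = lookup X (u ↑ˡ n)
      xʳ u = lookup X (n ↑ʳ u)

      -- On the second side the unprimed count is of vertices outside `X`. Thus `i * k` counts the
      -- crossing pairs of weight `b`, and the cut weight is symmetric under exchanging the two
      -- sides.
      i i′ k k′ : Carrier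
      i  = sumˡ χ
      i′ = sumˡ χᶜ
      k  = sumʳ χᶜ
      k′ = sumʳ χ

      i+i′≈n : i + i′ ≈ ι n
      i+i′≈n = sum-indicator-complement xˡ

      k+k′≈n : k + k′ ≈ ι n
      k+k′≈n = trans (+-comm k k′) (sum-indicator-complement xʳ)

      i-nonneg : 0# ≤ i
      i-nonneg = sum-indicator-nonneg xˡ

      i′-nonneg : 0# ≤ i′
      i′-nonneg = sum-indicator-nonneg (not ∘ xˡ)

      k-nonneg : 0# ≤ k
      k-nonneg = sum-indicator-nonneg (not ∘ xʳ)

      k′-nonneg : 0# ≤ k′
      k′-nonneg = sum-indicator-nonneg xʳ

      -- `sum-sides` is applied twice, first over the heads `v` with `χᶜ` and then over the tails
      -- `u` with `χ`.
      cut-value : cutWeight D X (∁ X) ≈ a * (i * i′ + k * k′) + b * (i * k)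
      cut-value = begin
        cutWeight D X (∁ X)
          ≈⟨ sum-cong-≋ (λ u → sum-cong-≋ (cut-term u)) ⟩
        ∑[ u < n ℕ.+ n ] ∑[ v < n ℕ.+ n ] (χ u * (χᶜ v * sideWeight (side u) (side v)))
          ≈⟨ sum-cong-≋ (λ u → *-distribˡ-sum (χ u) (λ v → χᶜ v * sideWeight (side u) (side v))) ⟨
        ∑[ u < n ℕ.+ n ] (χ u * ∑[ v < n ℕ.+ n ] (χᶜ v * sideWeight (side u) (side v)))
          ≈⟨ sum-cong-≋ (λ u → *-congˡ {χ u} (sum-sides χᶜ (sideWeight (side u)))) ⟩
        ∑[ u < n ℕ.+ n ] (χ u * (i′ * sideWeight (side u) true + k * sideWeight (side u) false))
          ≈⟨ sum-sides χ (λ s → i′ * sideWeight s true + k * sideWeight s false) ⟩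
        i * (i′ * a + k * b) + k′ * (i′ * 0# + k * a)
          ≈⟨ solve 6 (λ i i′ k k′ a b →
               i :* (i′ :* a :+ k :* b) :+ k′ :* (i′ :* con 0 :+ k :* a)
               := a :* (i :* i′ :+ k :* k′) :+ b :* (i :* k)) refl i i′ k k′ a b ⟩
        a * (i * i′ + k * k′) + b * (i * k) ∎

    firstSide : Subset (n ℕ.+ n)
    firstSide = tabulate side

    -- Both primed counts vanish, so no inner arc crosses and every arc of weight `b` does.
    firstSide-cut : cutWeight D firstSide (∁ firstSide) ≈ ι n * ι n * b
    firstSide-cut = begin
      cutWeight D firstSide (∁ firstSide)  ≈⟨ cut-value ⟩
      a * (i * i′ + k * k′) + b * (i * k)
        ≈⟨ +-cong (*-congˡ (+-cong (*-congˡ i′≈0) (*-congˡ k′≈0))) (*-congˡ (*-cong i≈n k≈n)) ⟩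
      a * (i * 0# + k * 0#) + b * (ι n * ι n)
        ≈⟨ solve 5 (λ a b i k n → a :* (i :* con 0 :+ k :* con 0) :+ b :* (n :* n)
             := n :* n :* b) refl a b i k (ι n) ⟩
      ι n * ι n * b                        ∎
      where
      open Cut firstSide

      inFirst : ∀ j → lookup firstSide (j ↑ˡ n) ≡ true
      inFirst j = ≡.trans (lookup∘tabulate side (j ↑ˡ n)) (side-↑ˡ j)

      inSecond : ∀ j → lookup firstSide (n ↑ʳ j) ≡ false
      inSecond j = ≡.trans (lookup∘tabulate side (n ↑ʳ j)) (side-↑ʳ j)

      i≈n : i ≈ ι n
      i≈n = trans (≡⇒≈ (sum-cong-≗ (≡.cong indicator ∘ inFirst))) (sum-replicate n)

      i′≈0 : i′ ≈ 0#
      i′≈0 = trans (≡⇒≈ (sum-cong-≗ (≡.cong (indicator ∘ not) ∘ inFirst))) (sum-replicate-zero n)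

      k≈n : k ≈ ι n
      k≈n = trans (≡⇒≈ (sum-cong-≗ (≡.cong (indicator ∘ not) ∘ inSecond))) (sum-replicate n)

      k′≈0 : k′ ≈ 0#
      k′≈0 = trans (≡⇒≈ (sum-cong-≗ (≡.cong indicator ∘ inSecond))) (sum-replicate-zero n)

-- Choice of the weights, and bounds on all cuts.

module Bounds {c ℓ₁ ℓ₂} (ℝ : CompleteOrderedField c ℓ₁ ℓ₂) where
  open CompleteOrderedField ℝ
  open WeightedDigraphs ℝ
  open CommutativeRing commutativeRing
    using ( refl; sym; trans; +-cong; +-congˡ; +-congʳ; +-assoc; +-comm
          ; *-cong; *-congˡ; *-congʳ; *-assoc; *-comm; *-identityʳ
          ; distribˡ; commutativeSemiring; +-group)
  open DecTotalOrder decTotalOrder using (poset; antisym; ≤-respʳ-≈)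
    renaming (trans to ≤-trans)
  open DecTotalOrderProperties decTotalOrder
    using (<-respˡ-≈; <-respʳ-≈; <-irrefl; ≤∧≉⇒<)
  open OrderedField ℝ
  open TwoCliques ℝ
  open GroupProperties +-group using () renaming (∙-cancelˡ to +-cancelˡ)
  open NatSolver commutativeSemiring using (solve; _:=_; _:+_; _:*_; con)
  open PartialOrderReasoning poset

  l-below : ∀ {θ} → θ < 1# / 3# → l θ ≡ 1# / 4# + (θ * θ) / (4# * (1# - 2# * θ))
  l-below {θ} θ<1/3 = ≡.cong
    (λ b → if b then 1# / 4# + (θ * θ) / (4# * (1# - 2# * θ)) else θ)
    (dec-true (θ <? 1# / 3#) θ<1/3)

  l-above : ∀ {θ} → ¬ θ < 1# / 3# → l θ ≡ θ
  l-above {θ} θ≮1/3 = ≡.cong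
    (λ b → if b then 1# / 4# + (θ * θ) / (4# * (1# - 2# * θ)) else θ)
    (dec-false (θ <? 1# / 3#) θ≮1/3)

  module _ (θ : Carrier) (0≤θ : 0# ≤ θ) (θ≤1 : θ ≤ 1#) where
    -- The share of the total weight that lies inside the two cliques; `θ` is the share between
    -- them.
    φ : Carrier
    φ = 1# - θ

    0≤φ : 0# ≤ φ
    0≤φ = x≤y⇒0≤y-x θ≤1

    θ+φ≈1 : θ + φ ≈ 1#
    θ+φ≈1 = x+[y-x]≈y θ 1#

    module _ (m′ : ℕ) where
      -- There are `2NM` inner pairs and `N²` pairs from first to second side. These weights give
      -- them totals `φ` and `θ` times the same quantity `2N²M`. Taking `m` to be a successor keeps
      -- `M`, and hence the total weight, positive.
      m N M a b : _
      m = suc m′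
      M = ι m
      N = ι (suc m)
      a = φ * N
      b = 2# * (θ * M)

      0<M : 0# < M
      0<M = ι-pos m′

      0<N : 0# < N
      0<N = ι-pos m

      0≤a : 0# ≤ a
      0≤a = *-nonneg 0≤φ (proj₁ 0<N)

      0≤b : 0# ≤ b
      0≤b = *-nonneg (proj₁ 0<2) (*-nonneg 0≤θ (proj₁ 0<M))

      G : WeightedDigraph
      G = D m 0≤a 0≤b

      totalWeight-G : totalWeight G ≈ 2# * (N * N * M)
      totalWeight-G = begin-equality
        totalWeight G                              ≈⟨ totalWeight-value m 0≤a 0≤b ⟩
        N * (2# * (M * (φ * N)) + N * (2# * (θ * M)))
          ≈⟨ solve 4 (λ N M θ φ → N :* (con 2 :* (M :* (φ :* N)) :+ N :* (con 2 :* (θ :* M)))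
               := con 2 :* (N :* N :* M) :* (θ :+ φ)) refl N M θ φ ⟩
        2# * (N * N * M) * (θ + φ)                 ≈⟨ *-congˡ θ+φ≈1 ⟩
        2# * (N * N * M) * 1#                      ≈⟨ *-identityʳ _ ⟩
        2# * (N * N * M)                           ∎

      0<totalWeight-G : 0# < totalWeight G
      0<totalWeight-G = <-respʳ-≈ (sym totalWeight-G) (*-pos 0<2 (*-pos (*-pos 0<N 0<N) 0<M))

      NNb≈θw : N * N * b ≈ θ * totalWeight G
      NNb≈θw = begin-equality
        N * N * (2# * (θ * M))  ≈⟨ solve 3 (λ N M θ → N :* N :* (con 2 :* (θ :* M))
                                     := θ :* (con 2 :* (N :* N :* M))) refl N M θ ⟩
        θ * (2# * (N * N * M))  ≈⟨ *-congˡ totalWeight-G ⟨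
        θ * totalWeight G       ∎

      θ[G]≈θ : θ[ G ] ≈ θ
      θ[G]≈θ = begin-equality
        r⁺ G * totalWeight G ⁻¹  ≈⟨ *-congʳ (trans (r⁺-value m 0≤a 0≤b) NNb≈θw) ⟩
        θ * totalWeight G * totalWeight G ⁻¹    ≈⟨ *-assoc _ _ _ ⟩
        θ * (totalWeight G * totalWeight G ⁻¹)
          ≈⟨ *-congˡ (*-inverseʳ _ (pos⇒nonzero 0<totalWeight-G)) ⟩
        θ * 1#                                  ≈⟨ *-identityʳ θ ⟩
        θ                                       ∎

    -- The range up to 1/3.

    module Small (θ≤1/3 : θ ≤ 1# / 3#) where
      -- The factor in the denominator of `l`. Cuts are compared after multiplication by `4# * ψ`,
      -- which avoids division.
      ψ : Carrier
      ψ = 1# - 2# * θ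

      2θ+ψ≈1 : 2# * θ + ψ ≈ 1#
      2θ+ψ≈1 = x+[y-x]≈y (2# * θ) 1#

      θ+ψ≈φ : θ + ψ ≈ φ
      θ+ψ≈φ = +-cancelˡ θ (θ + ψ) φ (begin-equality
        θ + (θ + ψ)  ≈⟨ solve 2 (λ θ ψ → θ :+ (θ :+ ψ) := con 2 :* θ :+ ψ) refl θ ψ ⟩
        2# * θ + ψ   ≈⟨ 2θ+ψ≈1 ⟩
        1#           ≈⟨ θ+φ≈1 ⟨
        θ + φ        ∎)

      -- `ψ` exceeds `θ` by `1# - 3# * θ`, which is nonnegative in this range; `2# * θ` is added to
      -- both sides to compare them.
      θ≤ψ : θ ≤ ψ
      θ≤ψ = ≤-respʳ-≈ (+-cancelˡ (2# * θ) _ _ cancelled)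
                      (x≤x+nonneg θ (x≤y⇒0≤y-x 3θ≤1))
        where
        3θ≤1 : 3# * θ ≤ 1#
        3θ≤1 = ≤-respʳ-≈ (y*[x/y]≈x 0<3) (*-monoˡ-≤ (proj₁ 0<3) θ≤1/3)

        cancelled : 2# * θ + (θ + (1# - 3# * θ)) ≈ 2# * θ + ψ
        cancelled = begin-equality
          2# * θ + (θ + (1# - 3# * θ))
            ≈⟨ solve 2 (λ θ z → con 2 :* θ :+ (θ :+ z) := con 3 :* θ :+ z) refl θ _ ⟩
          3# * θ + (1# - 3# * θ)
            ≈⟨ x+[y-x]≈y (3# * θ) 1# ⟩
          1#
            ≈⟨ 2θ+ψ≈1 ⟨
          2# * θ + ψ ∎

      0≤ψ : 0# ≤ ψ
      0≤ψ = ≤-trans 0≤θ θ≤ψ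

      -- If `ψ` vanished, so would `θ`, being between zero and `ψ`; but `2# * θ + ψ` is `1#`.
      0<ψ : 0# < ψ
      0<ψ = ≤∧≉⇒< 0≤ψ λ 0≈ψ → 0≉1 (begin-equality
        0#             ≈⟨ solve 0 (con 0 := con 2 :* con 0 :+ con 0) refl ⟩
        2# * 0# + 0#   ≈⟨ +-cong (*-congˡ (antisym 0≤θ (≤-respʳ-≈ (sym 0≈ψ) θ≤ψ))) 0≈ψ ⟩
        2# * θ + ψ     ≈⟨ 2θ+ψ≈1 ⟩
        1#             ∎)

      0<φ : 0# < φ
      0<φ = <-respʳ-≈ (trans (+-comm ψ θ) θ+ψ≈φ) (+-pos 0<ψ 0≤θ)

      -- Clearing denominators in `l` leaves `ψ + θ²`. Writing `ψ` as `ψ (2θ + ψ)` turns this into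
      -- `(θ + ψ)²`.
      4ψl≈φ² : 4# * ψ * l θ ≈ φ * φ
      4ψl≈φ² = [ at-threshold , below-threshold ]′ (toSum (θ ≟ 1# / 3#))
        where
        below-threshold : ¬ θ ≈ 1# / 3# → 4# * ψ * l θ ≈ φ * φ
        below-threshold θ≉1/3 = begin-equality
          4# * ψ * l θ
            ≡⟨ ≡.cong (4# * ψ *_) (l-below (≤∧≉⇒< θ≤1/3 θ≉1/3)) ⟩
          4# * ψ * (1# / 4# + (θ * θ) / (4# * ψ))
            ≈⟨ distribˡ _ _ _ ⟩
          4# * ψ * (1# / 4#) + 4# * ψ * ((θ * θ) / (4# * ψ))
            ≈⟨ +-congˡ (y*[x/y]≈x (*-pos 0<4 0<ψ)) ⟩
          4# * ψ * (1# / 4#) + θ * θ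
            ≈⟨ +-congʳ (trans (*-congʳ (*-comm 4# ψ)) (*-assoc ψ 4# _)) ⟩
          ψ * (4# * (1# / 4#)) + θ * θ
            ≈⟨ +-congʳ (*-congˡ (trans (y*[x/y]≈x 0<4) (sym 2θ+ψ≈1))) ⟩
          ψ * (2# * θ + ψ) + θ * θ
            ≈⟨ solve 2 (λ θ ψ → ψ :* (con 2 :* θ :+ ψ) :+ θ :* θ
                 := (θ :+ ψ) :* (θ :+ ψ)) refl θ ψ ⟩
          (θ + ψ) * (θ + ψ)
            ≈⟨ *-cong θ+ψ≈φ θ+ψ≈φ ⟩
          φ * φ ∎

        -- At 1/3 the strict test in `l` selects the second branch. The formula persists because
        -- there `ψ` equals `θ` and `φ` equals `2θ`.
        at-threshold : θ ≈ 1# / 3# → 4# * ψ * l θ ≈ φ * φ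
        at-threshold θ≈1/3 = begin-equality
          4# * ψ * l θ       ≡⟨ ≡.cong (4# * ψ *_) (l-above (<-irrefl θ≈1/3)) ⟩
          4# * ψ * θ         ≈⟨ *-congʳ (*-congˡ ψ≈θ) ⟩
          4# * θ * θ         ≈⟨ solve 1 (λ θ → con 4 :* θ :* θ := (θ :+ θ) :* (θ :+ θ)) refl θ ⟩
          (θ + θ) * (θ + θ)  ≈⟨ *-cong θ+θ≈φ θ+θ≈φ ⟩
          φ * φ              ∎
          where
          ψ≈θ : ψ ≈ θ
          ψ≈θ = +-cancelˡ (2# * θ) ψ θ (begin-equality
            2# * θ + ψ       ≈⟨ 2θ+ψ≈1 ⟩
            1#               ≈⟨ y*[x/y]≈x 0<3 ⟨
            3# * (1# / 3#)   ≈⟨ *-congˡ θ≈1/3 ⟨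
            3# * θ           ≈⟨ solve 1 (λ θ → con 3 :* θ := con 2 :* θ :+ θ) refl θ ⟩
            2# * θ + θ       ∎)

          θ+θ≈φ : θ + θ ≈ φ
          θ+θ≈φ = trans (+-congˡ (sym ψ≈θ)) θ+ψ≈φ

      -- 4AB ≤ (A + B)² for A = ψ i and B = φ i′ + θ i, whose sum is φ (i + i′).
      side-bound : ∀ {i i′ n} → i + i′ ≈ n →
                   4# * ψ * (φ * (i * i′) + θ * (i * i)) ≤ φ * φ * (n * n)
      side-bound {i} {i′} {n} i+i′≈n = begin
        4# * ψ * (φ * (i * i′) + θ * (i * i))
          ≈⟨ solve 5 (λ ψ φ θ i i′ → con 4 :* ψ :* (φ :* (i :* i′) :+ θ :* (i :* i))
               := con 4 :* (ψ :* i :* (φ :* i′ :+ θ :* i))) refl ψ φ θ i i′ ⟩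
        4# * (ψ * i * (φ * i′ + θ * i))
          ≤⟨ 4xy≤[x+y]² (ψ * i) (φ * i′ + θ * i) ⟩
        (ψ * i + (φ * i′ + θ * i)) * (ψ * i + (φ * i′ + θ * i))
          ≈⟨ *-cong sum≈φn sum≈φn ⟩
        φ * n * (φ * n)
          ≈⟨ solve 2 (λ φ n → φ :* n :* (φ :* n) := φ :* φ :* (n :* n)) refl φ n ⟩
        φ * φ * (n * n) ∎
        where
        sum≈φn : ψ * i + (φ * i′ + θ * i) ≈ φ * n
        sum≈φn = begin-equality
          ψ * i + (φ * i′ + θ * i) ≈⟨ solve 5 (λ ψ φ θ i i′ → ψ :* i :+ (φ :* i′ :+ θ :* i)
                                        := (θ :+ ψ) :* i :+ φ :* i′) refl ψ φ θ i i′ ⟩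
          (θ + ψ) * i + φ * i′     ≈⟨ +-congʳ (*-congʳ θ+ψ≈φ) ⟩
          φ * i + φ * i′           ≈⟨ distribˡ φ i i′ ⟨
          φ * (i + i′)             ≈⟨ *-congˡ i+i′≈n ⟩
          φ * n                    ∎

      module _ (ε : Carrier) (m′ : ℕ) (1<εμ : 1# < ε * ι (suc m′)) where
        private
          g = G m′
          n = N m′
          μ = M m′

        -- `cross` removes the mixed term `i * k`, so the bound splits into one expression in `i`,
        -- `i′` and one in `k`, `k′`, each handled by `side-bound`.
        scaled-cut : ∀ X → 4# * ψ * cutWeight g X (∁ X) ≤ φ * φ * (2# * (n * n)) * n
        scaled-cut X = begin
          4# * ψ * cutWeight g X (∁ X)
            ≈⟨ *-congˡ cut-value ⟩
          4# * ψ * (φ * n * (i * i′ + k * k′) + 2# * (θ * μ) * (i * k))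
            ≤⟨ *-monoˡ-≤ 0≤4ψ (+-monoʳ-≤ _ cross) ⟩
          4# * ψ * (φ * n * (i * i′ + k * k′) + θ * n * (i * i + k * k))
            ≈⟨ solve 8 (λ f φ θ n i i′ k k′ →
                 f :* (φ :* n :* (i :* i′ :+ k :* k′) :+ θ :* n :* (i :* i :+ k :* k))
                 := n :* (f :* (φ :* (i :* i′) :+ θ :* (i :* i)) :+ f :* (φ :* (k :* k′) :+ θ :* (k :* k))))
                 refl (4# * ψ) φ θ n i i′ k k′ ⟩
          n * (4# * ψ * (φ * (i * i′) + θ * (i * i)) + 4# * ψ * (φ * (k * k′) + θ * (k * k)))
            ≤⟨ *-monoˡ-≤ (proj₁ (0<N m′)) (+-mono-≤ (side-bound i+i′≈n) (side-bound k+k′≈n)) ⟩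
          n * (φ * φ * (n * n) + φ * φ * (n * n))
            ≈⟨ solve 2 (λ n φ → n :* (φ :* φ :* (n :* n) :+ φ :* φ :* (n :* n))
                 := φ :* φ :* (con 2 :* (n :* n)) :* n) refl n φ ⟩
          φ * φ * (2# * (n * n)) * n ∎
          where
          open Cut (m m′) (0≤a m′) (0≤b m′) X

          0≤4ψ : 0# ≤ 4# * ψ
          0≤4ψ = *-nonneg (proj₁ 0<4) 0≤ψ

          -- After the mixed product is replaced by squares, `μ` is raised to `n` so that both
          -- summands of the cut weight carry the factor `n`.
          cross : 2# * (θ * μ) * (i * k) ≤ θ * n * (i * i + k * k)
          cross = begin
            2# * (θ * μ) * (i * k)   ≈⟨ solve 4 (λ θ M i k → con 2 :* (θ :* M) :* (i :* k)
                                           := θ :* M :* (con 2 :* (i :* k))) refl θ μ i k ⟩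
            θ * μ * (2# * (i * k))   ≤⟨ *-monoˡ-≤ (*-nonneg 0≤θ (proj₁ (0<M m′))) (2xy≤x²+y² i k) ⟩
            θ * μ * (i * i + k * k)  ≤⟨ *-monoʳ-≤ 0≤squares (*-monoˡ-≤ 0≤θ μ≤n) ⟩
            θ * n * (i * i + k * k)  ∎
            where
            0≤squares : 0# ≤ i * i + k * k
            0≤squares = +-nonneg (*-nonneg i-nonneg i-nonneg) (*-nonneg k-nonneg k-nonneg)

            μ≤n : μ ≤ n
            μ≤n = ≤-respʳ-≈ (+-comm μ 1#) (x≤x+nonneg μ 0≤1)

        -- The extra 1 by which `n` exceeds `μ` is absorbed by `ε * μ`; the size of `m′` is chosen
        -- for this.
        n<[1+ε]μ : n < (1# + ε) * μ
        n<[1+ε]μ = begin-strict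
          1# + μ        <⟨ +-monoˡ-< μ 1<εμ ⟩
          ε * μ + μ     ≈⟨ solve 2 (λ e M → e :* M :+ M := (con 1 :+ e) :* M) refl ε μ ⟩
          (1# + ε) * μ  ∎

        -- After scaling, `φ * φ` stands for `4# * ψ * l θ`. The strict inequality comes from
        -- replacing one factor `n` by `(1# + ε) * μ`.
        mac-small : mac g < (1# + ε) * l θ * totalWeight g
        mac-small = mac-< g λ X → *-cancelˡ-< (*-nonneg (proj₁ 0<4) 0≤ψ) (begin-strict
          4# * ψ * cutWeight g X (∁ X)
            ≤⟨ scaled-cut X ⟩
          φ * φ * (2# * (n * n)) * n
            <⟨ *-monoˡ-< (*-pos (*-pos 0<φ 0<φ) (*-pos 0<2 (*-pos (0<N m′) (0<N m′)))) n<[1+ε]μ ⟩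
          φ * φ * (2# * (n * n)) * ((1# + ε) * μ)
            ≈⟨ *-congʳ (*-congʳ 4ψl≈φ²) ⟨
          4# * ψ * l θ * (2# * (n * n)) * ((1# + ε) * μ)
            ≈⟨ solve 5 (λ f l n e M → f :* l :* (con 2 :* (n :* n)) :* (e :* M)
                 := f :* (e :* l :* (con 2 :* (n :* n :* M)))) refl (4# * ψ) (l θ) n (1# + ε) μ ⟩
          4# * ψ * ((1# + ε) * l θ * (2# * (n * n * μ)))
            ≈⟨ *-congˡ (*-congˡ (totalWeight-G m′)) ⟨
          4# * ψ * ((1# + ε) * l θ * totalWeight g) ∎)

    -- The range above 1/3.

    δ : Carrier
    δ = 3# * θ - 1#

    -- This rewrites the condition that `a` is at most `b`, that is `φ (1 + M) ≤ 2θM`, as `φ ≤ Mδ`.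
    φ+δ≈2θ : φ + δ ≈ 2# * θ
    φ+δ≈2θ = +-cancelˡ θ (φ + δ) (2# * θ) (begin-equality
      θ + (φ + δ)  ≈⟨ +-assoc θ φ δ ⟨
      θ + φ + δ    ≈⟨ +-congʳ θ+φ≈1 ⟩
      1# + δ       ≈⟨ x+[y-x]≈y 1# (3# * θ) ⟩
      3# * θ       ≈⟨ solve 1 (λ θ → con 3 :* θ := θ :+ con 2 :* θ) refl θ ⟩
      θ + 2# * θ   ∎)

    0<δ : 1# / 3# < θ → 0# < δ
    0<δ 1/3<θ = x<y⇒0<y-x (<-respˡ-≈ (y*[x/y]≈x 0<3) (*-monoˡ-< 0<3 1/3<θ))

    module _ (m′ : ℕ) (φ≤Mδ : φ ≤ ι (suc m′) * δ) where
      private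
        g = G m′
        n = N m′
        μ = M m′

      a≤b : a m′ ≤ b m′
      a≤b = begin
        φ * (1# + μ)      ≈⟨ solve 2 (λ φ M → φ :* (con 1 :+ M) := φ :+ M :* φ) refl φ μ ⟩
        φ + μ * φ         ≤⟨ +-monoˡ-≤ (μ * φ) φ≤Mδ ⟩
        μ * δ + μ * φ     ≈⟨ solve 3 (λ M φ δ → M :* δ :+ M :* φ := M :* (φ :+ δ)) refl μ φ δ ⟩
        μ * (φ + δ)       ≈⟨ *-congˡ φ+δ≈2θ ⟩
        μ * (2# * θ)      ≈⟨ solve 2 (λ M θ → M :* (con 2 :* θ) := con 2 :* (θ :* M)) refl μ θ ⟩
        2# * (θ * μ)      ∎

      -- Raising `a` to `b` gives all counted pairs the same weight, and `count` shows that there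
      -- are at most `n * n` of them.
      cut-large : ∀ X → cutWeight g X (∁ X) ≤ n * n * b m′
      cut-large X = begin
        cutWeight g X (∁ X)
          ≈⟨ cut-value ⟩
        a m′ * (i * i′ + k * k′) + b m′ * (i * k)
          ≤⟨ +-monoˡ-≤ _ (*-monoʳ-≤ 0≤inside a≤b) ⟩
        b m′ * (i * i′ + k * k′) + b m′ * (i * k)
          ≈⟨ solve 3 (λ b p q → b :* p :+ b :* q := b :* (p :+ q)) refl (b m′) (i * i′ + k * k′) (i * k) ⟩
        b m′ * (i * i′ + k * k′ + i * k)
          ≤⟨ *-monoˡ-≤ (0≤b m′) count ⟩
        b m′ * (n * n)
          ≈⟨ *-comm (b m′) (n * n) ⟩
        n * n * b m′ ∎
        where
        open Cut (m m′) (0≤a m′) (0≤b m′) X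

        0≤inside : 0# ≤ i * i′ + k * k′
        0≤inside = +-nonneg (*-nonneg i-nonneg i′-nonneg) (*-nonneg k-nonneg k′-nonneg)

        -- Twice the left side is at most (i + i′)² + (k + k′)² by 2ik ≤ i² + k².
        count : i * i′ + k * k′ + i * k ≤ n * n
        count = *-cancelˡ-≤ 0<2 (begin
          2# * (i * i′ + k * k′ + i * k)
            ≈⟨ solve 4 (λ i i′ k k′ → con 2 :* (i :* i′ :+ k :* k′ :+ i :* k)
                 := con 2 :* (i :* k) :+ con 2 :* (i :* i′ :+ k :* k′)) refl i i′ k k′ ⟩
          2# * (i * k) + 2# * (i * i′ + k * k′)
            ≤⟨ +-monoˡ-≤ _ (2xy≤x²+y² i k) ⟩
          i * i + k * k + 2# * (i * i′ + k * k′)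
            ≤⟨ x≤x+nonneg _ (+-nonneg (*-nonneg i′-nonneg i′-nonneg) (*-nonneg k′-nonneg k′-nonneg)) ⟩
          i * i + k * k + 2# * (i * i′ + k * k′) + (i′ * i′ + k′ * k′)
            ≈⟨ solve 4 (λ i i′ k k′ →
                 i :* i :+ k :* k :+ con 2 :* (i :* i′ :+ k :* k′) :+ (i′ :* i′ :+ k′ :* k′)
                 := (i :+ i′) :* (i :+ i′) :+ (k :+ k′) :* (k :+ k′)) refl i i′ k k′ ⟩
          (i + i′) * (i + i′) + (k + k′) * (k + k′)
            ≈⟨ +-cong (*-cong i+i′≈n i+i′≈n) (*-cong k+k′≈n k+k′≈n) ⟩
          n * n + n * n
            ≈⟨ solve 1 (λ n → n :* n :+ n :* n := con 2 :* (n :* n)) refl n ⟩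
          2# * (n * n) ∎)

      -- The cut at the first side attains the upper bound of `cut-large`.
      mac-large : mac g ≈ θ * totalWeight g
      mac-large = begin-equality
        mac g                     ≈⟨ mac-≈ g X₀ (λ X → ≤-respʳ-≈ (sym cut₀) (cut-large X)) ⟩
        cutWeight g X₀ (∁ X₀)     ≈⟨ cut₀ ⟩
        n * n * b m′              ≈⟨ NNb≈θw m′ ⟩
        θ * totalWeight g         ∎
        where
        X₀ = firstSide (m m′) (0≤a m′) (0≤b m′)
        cut₀ = firstSide-cut (m m′) (0≤a m′) (0≤b m′)

mainTheorem8 :
    ∀ {c ℓ₁ ℓ₂} (ℝ : CompleteOrderedField c ℓ₁ ℓ₂) →
    let open CompleteOrderedField ℝ
        open WeightedDigraphs ℝ
    in
    (θ : Carrier) → 0# ≤ θ → θ ≤ 1# →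
    (θ ≤ 1# / 3# →
      ∀ ε → 0# < ε →
      ∃ λ (D : WeightedDigraph) →
        0# < totalWeight D ×
        θ[ D ] ≈ θ ×
        mac D < (1# + ε) * l θ * totalWeight D)
    ×
    (1# / 3# < θ →
      ∃ λ (D : WeightedDigraph) →
        0# < totalWeight D ×
        θ[ D ] ≈ θ ×
        mac D ≈ θ * totalWeight D ×
        θ * totalWeight D ≈ l θ * totalWeight D)
mainTheorem8 ℝ θ 0≤θ θ≤1 = small , large
  where
  open CompleteOrderedField ℝ
  open CommutativeRing commutativeRing using (*-comm; *-congʳ) renaming (reflexive to ≡⇒≈)
  open DecTotalOrderProperties decTotalOrder using (<-respʳ-≈; <-asym)
  open OrderedField ℝ using (archimedean)
  open Bounds ℝ

  small = λ θ≤1/3 ε 0<ε →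
    -- A multiple of `ε` beyond `1#` brings the ratio of clique size `M + 1` to `M` below `1# + ε`.
    let m , 1<Mε = archimedean 1# 0<ε
    in G θ 0≤θ θ≤1 m , 0<totalWeight-G θ 0≤θ θ≤1 m , θ[G]≈θ θ 0≤θ θ≤1 m
     , Small.mac-small θ 0≤θ θ≤1 θ≤1/3 ε m (<-respʳ-≈ (*-comm _ ε) 1<Mε)

  large = λ 1/3<θ →
    -- A multiple of `δ` beyond `φ` makes the weight between the cliques at least the inner one.
    let m , φ<Mδ = archimedean (φ θ 0≤θ θ≤1) (0<δ θ 0≤θ θ≤1 1/3<θ)
    in G θ 0≤θ θ≤1 m , 0<totalWeight-G θ 0≤θ θ≤1 m , θ[G]≈θ θ 0≤θ θ≤1 m
     , mac-large θ 0≤θ θ≤1 m (proj₁ φ<Mδ)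
     , *-congʳ (≡⇒≈ (≡.sym (l-above (<-asym 1/3<θ))))
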